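{- Let $G$ be a finite simple bipartite graph. Then there exist disjoint sets $S,T$ with $S\cup T=V(G)$ satisfying the following conditions: (a) $G$ has a matching $M$ with $M\subseteq E_G(S,T)$ such that $M$ saturates $S$; (b) $T$ is an independent set in $G$.
   Context: All graphs are finite and simple. For disjoint $S,T\subseteq V(G)$, $E_G(S,T)$ is the set of edges of $G$ with one endvertex in $S$ and the other in $T$. A matching $M$ saturates $S$ if every vertex of $S$ is an endvertex of an edge of $M$. The partition $S\cup T$ of $V(G)$ is not required to be a bipartition of $G$ (edges inside $S$ are allowed). -}

module Defs where

open import Data.Nat.Base using (ℕ)
open import Data.Fin.Base using (Fin)
open import Data.Fin.Subset using (Subset; _∈_; _∩_; _∪_; ⊤; Empty)
open import Data.Product.Base using (_×_; ∃; ∃₂)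
open import Data.Sum.Base using (_⊎_)
open import Level using (0ℓ)
open import Relation.Binary.Core using (Rel; _⇒_)
open import Relation.Binary.Definitions using (Decidable; Symmetric)
open import Relation.Binary.PropositionalEquality.Core using (_≡_)
open import Relation.Nullary.Negation.Core using (¬_)

-- Finite simple graphs with vertex set Fin n.  Decidability of adjacency
-- is the constructive counterpart of the edge set being a finite set.
record Graph (n : ℕ) : Set₁ where
  field
    Adj       : Rel (Fin n) 0ℓ
    adj-sym   : Symmetric Adj
    adj-irr   : ∀ {u} → ¬ Adj u u
    adj?      : Decidable Adj

open Graph public

record IsPartition {n : ℕ} (S T : Subset n) : Set where
  field
    disjoint : Empty (S ∩ T)
    covers   : S ∪ T ≡ ⊤

-- Edge sets are given as symmetric relations on vertices: E G S T u v says
-- that {u , v} is an edge with one endvertex in S and the other in T.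
E : ∀ {n} → Graph n → Subset n → Subset n → Rel (Fin n) 0ℓ
E G S T u v = Adj G u v × ((u ∈ S × v ∈ T) ⊎ (u ∈ T × v ∈ S))

Bipartite : ∀ {n} → Graph n → Set
Bipartite {n} G =
  ∃₂ λ (X Y : Subset n) → IsPartition X Y × (Adj G ⇒ E G X Y)

Independent : ∀ {n} → Graph n → Subset n → Set
Independent G T = ∀ {u v} → u ∈ T → v ∈ T → ¬ Adj G u v

-- A set of edges of G, no two distinct ones sharing an endvertex.  By
-- symmetry it is enough to compare edges {u , v}, {u , w} at their common
-- first endvertex; these are the same edge exactly when v ≡ w.
record Matching {n : ℕ} (G : Graph n) : Set₁ where
  field
    Edge      : Rel (Fin n) 0ℓ
    edge-sym  : Symmetric Edge
    edge?     : Decidable Edge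
    edge⇒adj  : Edge ⇒ Adj G
    unique    : ∀ {u v w} → Edge u v → Edge u w → v ≡ w

open Matching public

Saturates : ∀ {n} {G : Graph n} → Matching G → Subset n → Set
Saturates M S = ∀ {u} → u ∈ S → ∃ λ v → Edge M u v

{-# OPTIONS --safe #-}
-- Fix a bipartition X ∪ Y and take a matching that cannot be enlarged.  Let
-- R ⊆ X be the vertices reachable by alternating paths from the unmatched
-- vertices of X.  Every neighbour of R is then the partner of a vertex of R,
-- so S = (X ∖ R) ∪ N(R) is a vertex cover, each vertex of S is matched, and no
-- matching edge has both ends in S: this is König's theorem.
module Submission where

open import Defs
open import Data.Empty using (⊥-elim)
open import Data.Fin.Base using (Fin)
open import Data.Fin.Properties using (_≟_; any?)
open import Data.Fin.Subset using (Subset; _∈_; _∉_; _⊆_; _⊂_; _⊃_; _∪_; _-_; ⁅_⁆; ∁; ⊥)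
open import Data.Fin.Subset.Induction using (Acc; acc; ⊂-wellFounded; ⊃-wellFounded)
open import Data.Fin.Subset.Properties
open import Data.Nat.Base using (ℕ)
open import Data.Product.Base using (_×_; _,_; proj₂; ∃; ∃₂)
open import Data.Sum.Base using (_⊎_; inj₁; inj₂; [_,_]′; swap)
open import Data.Vec.Base using (tabulate)
open import Data.Vec.Functional using (updateAt)
open import Data.Vec.Functional.Properties using (updateAt-updates; updateAt-minimal)
open import Data.Vec.Properties using ([]=⇒lookup; lookup⇒[]=; lookup∘tabulate)
open import Function.Base using (_∘_; const; id)
open import Relation.Binary.Core using (_⇒_)
open import Relation.Binary.PropositionalEquality using (_≡_; _≢_; refl; sym; trans; subst)
open import Relation.Nullary using (¬_; Dec; yes; no; does; contradiction)
open import Relation.Nullary.Decidable using (_×-dec_; _⊎-dec_; ¬?; dec-true; decidable-stable)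
open import Relation.Unary using (Pred; Decidable)

-- Subsets cut out by decidable predicates.

module _ {n p} {P : Pred (Fin n) p} (P? : Decidable P) where

  comprehension : Subset n
  comprehension = tabulate (does ∘ P?)

  ∈-comprehension⁺ : ∀ {x} → P x → x ∈ comprehension
  ∈-comprehension⁺ {x} px =
    lookup⇒[]= x _ (trans (lookup∘tabulate (does ∘ P?) x) (dec-true (P? x) px))

  ∈-comprehension⁻ : ∀ {x} → x ∈ comprehension → P x
  ∈-comprehension⁻ {x} x∈ with P? x | trans (sym (lookup∘tabulate (does ∘ P?) x)) ([]=⇒lookup x∈)
  ... | yes px | _ = px

∁-isPartition : ∀ {n} (S : Subset n) → IsPartition S (∁ S)
∁-isPartition S = record
  { disjoint = λ (x , x∈) → let x∈S , x∈∁S = x∈p∩q⁻ S (∁ S) x∈ in x∈p⇒x∉∁p x∈S x∈∁S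
  ; covers   = p∪∁p≡⊤ S
  }

-- Matchings in a bipartite graph, the bipartition given by an independent vertex cover `X`.

module _ {n : ℕ} (G : Graph n) (X : Subset n)
         (X-independent : Independent G X)
         (X-covers : ∀ {u v} → Adj G u v → u ∈ X ⊎ v ∈ X) where

  -- A matching given by the partners m of the matched vertices D of X; the
  -- values of m outside D are irrelevant.
  record MatchingOn (D : Subset n) (m : Fin n → Fin n) : Set where
    field
      domain⊆X  : D ⊆ X
      adjacent  : ∀ {x} → x ∈ D → Adj G x (m x)
      injective : ∀ {x x′} → x ∈ D → x′ ∈ D → m x ≡ m x′ → x ≡ x′

  open MatchingOn

  Free : Subset n → (Fin n → Fin n) → Fin n → Set
  Free D m y = ∀ {x} → x ∈ D → m x ≢ y

  module _ (m : Fin n → Fin n) (z y : Fin n) where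

    reassign : Fin n → Fin n
    reassign = updateAt m z (const y)

    reassign-≡ : reassign z ≡ y
    reassign-≡ = updateAt-updates z m

    reassign-≢ : ∀ {x} → x ≢ z → reassign x ≡ m x
    reassign-≢ {x} = updateAt-minimal x z m

  -- Freeness of `y` keeps the partners distinct. Letting `D′` differ from `D` at `z` serves two
  -- uses: `D′ = D` moves `z` to the partner `y`, and `D′ = D ∪ ⁅ z ⁆` adds a new edge.
  reassign-matching : ∀ {D D′ m z y} → MatchingOn D m →
    (∀ {x} → x ∈ D′ → x ≢ z → x ∈ D) →
    z ∈ X → Adj G z y → Free D m y → MatchingOn D′ (reassign m z y)
  reassign-matching {D} {D′} {m} {z} {y} M D′⊆D z∈X zy y-free = record
    { domain⊆X = dom ; adjacent = adj ; injective = inj }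
    where
    dom : D′ ⊆ X
    dom {x} x∈ with x ≟ z
    ... | yes refl = z∈X
    ... | no x≢z = domain⊆X M (D′⊆D x∈ x≢z)

    adj : ∀ {x} → x ∈ D′ → Adj G x (reassign m z y x)
    adj {x} x∈ with x ≟ z
    ... | yes refl = subst (Adj G z) (sym (reassign-≡ m z y)) zy
    ... | no x≢z = subst (Adj G x) (sym (reassign-≢ m z y x≢z)) (adjacent M (D′⊆D x∈ x≢z))

    other≢y : ∀ {x} → x ∈ D′ → x ≢ z → reassign m z y x ≢ reassign m z y z
    other≢y x∈ x≢z eq = y-free (D′⊆D x∈ x≢z)
      (trans (sym (reassign-≢ m z y x≢z)) (trans eq (reassign-≡ m z y)))

    inj : ∀ {x x′} → x ∈ D′ → x′ ∈ D′ → reassign m z y x ≡ reassign m z y x′ → x ≡ x′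
    inj {x} {x′} x∈ x′∈ eq with x ≟ z | x′ ≟ z
    ... | yes refl | yes refl = refl
    ... | yes refl | no x′≢z = contradiction (sym eq) (other≢y x′∈ x′≢z)
    ... | no x≢z | yes refl = contradiction eq (other≢y x∈ x≢z)
    ... | no x≢z | no x′≢z = injective M (D′⊆D x∈ x≢z) (D′⊆D x′∈ x′≢z)
      (trans (sym (reassign-≢ m z y x≢z)) (trans eq (reassign-≢ m z y x′≢z)))

  PartnerOutside : Subset n → Subset n → (Fin n → Fin n) → Fin n → Set
  PartnerOutside U D m y = ∃ λ x → x ∈ D × x ∉ U × m x ≡ y

  partnerOutside? : ∀ U D m → Decidable (PartnerOutside U D m)
  partnerOutside? U D m y = any? λ x → (x ∈? D) ×-dec (¬? (x ∈? U) ×-dec (m x ≟ y))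

  -- U stands for the vertices of X that alternating paths do not reach.
  Closed : Subset n → Subset n → (Fin n → Fin n) → Set
  Closed U D m = ∀ {z y} → z ∈ X → z ∉ U → Adj G z y → PartnerOutside U D m y

  -- The search for an augmenting path.

  module _ {D : Subset n} {m : Fin n → Fin n} (M : MatchingOn D m) where

    -- Quantifying over all m′ that agree with m on the reached vertices lets
    -- an augmenting path be shortened from its far end: reassigning the last
    -- vertex does not disturb the part of the path before it.
    Augmentable : Set → Subset n → Set
    Augmentable A U = ∀ {m′ z y} → MatchingOn D m′ → (∀ {x} → x ∉ U → m′ x ≡ m x) →
      z ∈ X → z ∉ U → Adj G z y → Free D m′ y → A

    -- The vertex `x` becomes reached through `z` and `m x`. If `x` has a free neighbour `y′`,
    -- moving `x` to `y′` frees `m x`, a neighbour of the vertex `z` reached earlier, and `aug`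
    -- applies there.
    augmentable-step : ∀ {A U x z} → U ⊆ D → x ∈ U → z ∈ X → z ∉ U → Adj G z (m x) →
      Augmentable A U → Augmentable A (U - x)
    augmentable-step {A} {U} {x} {z} U⊆D x∈U z∈X z∉U zy aug {m′} {z′} {y′} M′ agree z′∈X z′∉ z′y′ y′-free
      with z′ ∈? U
    ... | no z′∉U = aug M′ (λ v∉U → agree (v∉U ∘ p─q⊆p U ⁅ x ⁆)) z′∈X z′∉U z′y′ y′-free
    ... | yes z′∈U with z′ ≟ x
    ...   | no z′≢x = contradiction (x∈p∧x≢y⇒x∈p-y z′∈U z′≢x) z′∉
    ...   | yes refl = aug M″ agree″ z∈X z∉U zy free″
      where
      m″ : Fin n → Fin n
      m″ = reassign m′ x y′

      M″ : MatchingOn D m″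
      M″ = reassign-matching M′ (λ v∈D _ → v∈D) z′∈X z′y′ y′-free

      agree″ : ∀ {v} → v ∉ U → m″ v ≡ m v
      agree″ v∉U = trans (reassign-≢ m′ x y′ λ { refl → v∉U x∈U })
                         (agree (v∉U ∘ p─q⊆p U ⁅ x ⁆))

      free″ : Free D m″ (m x)
      free″ {v} v∈D eq with v ≟ x
      -- `m′` agrees with `m` at `x`, so `eq` would make `y′` the partner of `x` under `m′`.
      ... | yes refl = y′-free v∈D
        (trans (agree z′∉) (trans (sym eq) (reassign-≡ m′ x y′)))
      ... | no v≢x = v≢x (injective M′ v∈D (U⊆D x∈U)
        (trans (sym (reassign-≢ m′ x y′ v≢x)) (trans eq (sym (agree z′∉)))))

    -- A failure of `Closed` is an edge from a reached `z` to some `y`. Either `y` is free and `aug`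
    -- applies, or `y` is the partner of some `x` in `U`, which is now reached and leaves `U`.
    closed-or-augmented : ∀ {A} U → Acc _⊂_ U → U ⊆ D → Augmentable A U →
      (∃ λ U′ → U′ ⊆ D × Closed U′ D m) ⊎ A
    closed-or-augmented U (acc rec) U⊆D aug
      with any? (λ z → any? (λ y →
        (z ∈? X) ×-dec (¬? (z ∈? U) ×-dec (adj? G z y ×-dec ¬? (partnerOutside? U D m y)))))
    ... | no none = inj₁ (U , U⊆D , λ {z} {y} z∈X z∉U zy →
      decidable-stable (partnerOutside? U D m y) λ ¬p → none (z , y , z∈X , z∉U , zy , ¬p))
    ... | yes (z , y , z∈X , z∉U , zy , ¬partner)
      with any? (λ x → (x ∈? D) ×-dec (m x ≟ y))
    ...   | no ¬matched = inj₂ (aug M (λ _ → refl) z∈X z∉U zy λ x∈D eq → ¬matched (_ , x∈D , eq))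
    ...   | yes (x , x∈D , refl) = closed-or-augmented (U - x) (rec (x∈p⇒p-x⊂p x∈U))
        (U⊆D ∘ p─q⊆p U ⁅ x ⁆) (augmentable-step U⊆D x∈U z∈X z∉U zy aug)
      where
      x∈U : x ∈ U
      x∈U = decidable-stable (x ∈? U) λ x∉U → ¬partner (x , x∈D , x∉U , refl)

  -- Repeated augmentation.

  ClosedMatching : Set
  ClosedMatching = ∃₂ λ D m → MatchingOn D m × ∃ λ U → U ⊆ D × Closed U D m

  enlarge : ∀ D m → Acc _⊃_ D → MatchingOn D m → ClosedMatching
  enlarge D m (acc rec) M = [ (λ closed → D , m , M , closed) , id ]′
    (closed-or-augmented M D (⊂-wellFounded D) id
      -- With `U = D` the reached vertices are the unmatched ones of `X`, so a free neighbour gives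
      -- a new edge. The result of augmenting is the recursive call itself, on a larger domain.
      λ {m′} {z} {y} M′ _ z∈X z∉D zy y-free →
        enlarge (D ∪ ⁅ z ⁆) (reassign m′ z y)
          (rec (p⊆p∪q ⁅ z ⁆ , z , q⊆p∪q D ⁅ z ⁆ (x∈⁅x⁆ z) , z∉D))
          (reassign-matching M′
            (λ x∈ x≢z → [ id , (λ x∈z → contradiction (x∈⁅y⁆⇒x≡y z x∈z) x≢z) ]′ (x∈p∪q⁻ D ⁅ z ⁆ x∈))
            z∈X zy y-free))

  closedMatching : ClosedMatching
  closedMatching = enlarge ⊥ id (⊃-wellFounded ⊥) record
    { domain⊆X  = ⊥-elim ∘ ∉⊥
    ; adjacent  = ⊥-elim ∘ ∉⊥
    ; injective = ⊥-elim ∘ ∉⊥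
    }

  -- The matching as an edge set, and its vertex cover.

  module _ {D : Subset n} {m : Fin n → Fin n} (M : MatchingOn D m) where

    Matched : Fin n → Fin n → Set
    Matched u v = u ∈ D × m u ≡ v

    matched-adj : ∀ {u v} → Matched u v → Adj G u v
    matched-adj (u∈D , refl) = adjacent M u∈D

    matched-∉X : ∀ {u v} → Matched u v → v ∉ X
    matched-∉X uv@(u∈D , _) v∈X = X-independent (domain⊆X M u∈D) v∈X (matched-adj uv)

    toMatching : Matching G
    toMatching = record
      { Edge     = λ u v → Matched u v ⊎ Matched v u
      ; edge-sym = swap
      ; edge?    = λ u v → matched? u v ⊎-dec matched? v u
      ; edge⇒adj = [ matched-adj , adj-sym G ∘ matched-adj ]′
      ; unique   = uniq
      }
      where
      matched? : ∀ u v → Dec (Matched u v)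
      matched? u v = (u ∈? D) ×-dec (m u ≟ v)

      uniq : ∀ {u v w} → Matched u v ⊎ Matched v u → Matched u w ⊎ Matched w u → v ≡ w
      uniq (inj₁ (_ , refl)) (inj₁ (_ , refl)) = refl
      uniq (inj₁ (u∈D , _)) (inj₂ wu) = contradiction (domain⊆X M u∈D) (matched-∉X wu)
      uniq (inj₂ vu) (inj₁ (u∈D , _)) = contradiction (domain⊆X M u∈D) (matched-∉X vu)
      uniq (inj₂ (v∈D , eq)) (inj₂ (w∈D , eq′)) = injective M v∈D w∈D (trans eq (sym eq′))

    module _ {U : Subset n} (U⊆D : U ⊆ D) (closed : Closed U D m) where

      -- The second alternative describes the neighbours of reached vertices: `closed` makes each of
      -- them such a partner, and partners are adjacent. In this form every vertex of the cover is
      -- visibly matched.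
      InCover : Fin n → Set
      InCover v = v ∈ U ⊎ PartnerOutside U D m v

      inCover? : Decidable InCover
      inCover? v = (v ∈? U) ⊎-dec partnerOutside? U D m v

      cover : Subset n
      cover = comprehension inCover?

      covered-from-X : ∀ {u v} → u ∈ X → Adj G u v → u ∈ cover ⊎ v ∈ cover
      covered-from-X {u} u∈X uv with u ∈? U
      ... | yes u∈U = inj₁ (∈-comprehension⁺ inCover? (inj₁ u∈U))
      ... | no u∉U = inj₂ (∈-comprehension⁺ inCover? (inj₂ (closed u∈X u∉U uv)))

      covered : ∀ {u v} → Adj G u v → u ∈ cover ⊎ v ∈ cover
      covered uv with X-covers uv
      ... | inj₁ u∈X = covered-from-X u∈X uv
      ... | inj₂ v∈X = swap (covered-from-X v∈X (adj-sym G uv))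

      ∁cover-independent : Independent G (∁ cover)
      ∁cover-independent u∈ v∈ uv = [ x∈∁p⇒x∉p u∈ , x∈∁p⇒x∉p v∈ ]′ (covered uv)

      -- By injectivity, `v` is the partner of `u` alone, so exactly one end is in the cover: `u` if
      -- `u` is in `U`, and `v` otherwise. Partners lie outside `X`, hence outside `U`, and `u` in
      -- `X` is no partner.
      matched-crosses : ∀ {u v} → Matched u v →
        (u ∈ cover × v ∈ ∁ cover) ⊎ (u ∈ ∁ cover × v ∈ cover)
      matched-crosses {u} {v} uv@(u∈D , mu≡v) with u ∈? U
      ... | yes u∈U = inj₁ (∈-comprehension⁺ inCover? (inj₁ u∈U) ,
        x∉p⇒x∈∁p (v∉ ∘ ∈-comprehension⁻ inCover?))
        where
        v∉ : ¬ InCover v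
        v∉ (inj₁ v∈U) = matched-∉X uv (domain⊆X M (U⊆D v∈U))
        v∉ (inj₂ (x , x∈D , x∉U , mx≡v)) =
          x∉U (subst (_∈ U) (injective M u∈D x∈D (trans mu≡v (sym mx≡v))) u∈U)
      ... | no u∉U = inj₂ (x∉p⇒x∈∁p (u∉ ∘ ∈-comprehension⁻ inCover?) ,
        ∈-comprehension⁺ inCover? (inj₂ (u , u∈D , u∉U , mu≡v)))
        where
        u∉ : ¬ InCover u
        u∉ (inj₁ u∈U) = u∉U u∈U
        u∉ (inj₂ (x , x∈D , _ , mx≡u)) = matched-∉X (x∈D , mx≡u) (domain⊆X M u∈D)

      edges-cross : Edge toMatching ⇒ E G cover (∁ cover)
      edges-cross (inj₁ uv) = matched-adj uv , matched-crosses uv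
      edges-cross (inj₂ vu) with matched-crosses vu
      ... | inj₁ (v∈ , u∈) = adj-sym G (matched-adj vu) , inj₂ (u∈ , v∈)
      ... | inj₂ (v∈ , u∈) = adj-sym G (matched-adj vu) , inj₁ (u∈ , v∈)

      saturates-cover : Saturates toMatching cover
      saturates-cover {u} u∈ with ∈-comprehension⁻ inCover? u∈
      ... | inj₁ u∈U = m u , inj₁ (U⊆D u∈U , refl)
      ... | inj₂ (x , x∈D , _ , mx≡u) = x , inj₂ (x∈D , mx≡u)

lemma9 : ∀ (n : ℕ) (G : Graph n) → Bipartite G →
    ∃₂ λ (S T : Subset n) →
    IsPartition S T
    × (∃ λ (M : Matching G) → (Edge M ⇒ E G S T) × Saturates M S)
    × Independent G T
lemma9 n G (X , Y , X⊎Y , bip) =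
  let D , m , M , U , U⊆D , closed = closedMatching G X X-independent X-covers
      S = cover G X X-independent X-covers M U⊆D closed
  in S , ∁ S , ∁-isPartition S
   , ( toMatching G X X-independent X-covers M
     , edges-cross G X X-independent X-covers M U⊆D closed
     , saturates-cover G X X-independent X-covers M U⊆D closed )
   , ∁cover-independent G X X-independent X-covers M U⊆D closed
  where
  X⇒∉Y : ∀ {v} → v ∈ X → v ∉ Y
  X⇒∉Y v∈X v∈Y = IsPartition.disjoint X⊎Y (_ , x∈p∩q⁺ (v∈X , v∈Y))

  X-independent : Independent G X
  X-independent u∈X v∈X uv with proj₂ (bip uv)
  ... | inj₁ (_ , v∈Y) = X⇒∉Y v∈X v∈Y
  ... | inj₂ (u∈Y , _) = X⇒∉Y u∈X u∈Y

  X-covers : ∀ {u v} → Adj G u v → u ∈ X ⊎ v ∈ X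
  X-covers uv with proj₂ (bip uv)
  ... | inj₁ (u∈X , _) = inj₁ u∈X
  ... | inj₂ (_ , v∈X) = inj₂ v∈X
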